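{- Let $\phi(x) = x^d + c$, where $c,d \in \mathbb{Z}$ and $d \geq 2$, and let $P_{d,c}$ be the set of primes $p$ such that $p \mid \phi^p(0)$. If $d$ is even, then $$P_{d,c} = \{2\} \cup \{p \text{ prime} : p \mid c\}.$$
   Context: Here $\phi^n$ denotes the $n$-th iterate of $\phi$. -}

module Defs where

open import Data.Integer using (ℤ; +_; 0ℤ; _+_; _^_)
open import Data.Integer.Divisibility.Signed using (_∣_)
open import Data.Nat using (ℕ)
open import Data.Nat.Primality using (Prime)
open import Data.Product using (_×_)
open import Function.Endo.Propositional ℤ using () renaming (_^_ to iterate)
open import Level using (0ℓ)
open import Relation.Unary using (Pred)

φ : ℕ → ℤ → ℤ → ℤ
φ d c x = x ^ d + c

-- `iterate f n` is the library's n-fold composite of the endomap f.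
P : ℕ → ℤ → Pred ℕ 0ℓ
P d c p = Prime p × + p ∣ iterate (φ d c) p 0ℤ

{-# OPTIONS --safe #-}

-- Modulo p the orbit of 0 returns to 0 after p steps.  For odd p the map φ
-- identifies 1 and -1, so its values at the first p orbit points lie in a set
-- of p - 1 residues and two of them agree.  Following the orbit from this
-- collision back to 0 gives a second return time k with 0 < k < p.  Since k is
-- coprime to p, the return time 1 follows, that is p ∣ φ(0) = c.

module Submission where

open import Defs
open import Data.Fin using (Fin; toℕ; fromℕ<)
open import Data.Fin.Properties using (pigeonhole; toℕ-fromℕ<; toℕ<n)
open import Data.Integer using (ℤ; +_; -_; _-_; 0ℤ; 1ℤ; _%ℕ_; _/ℕ_)
  renaming (_+_ to _+ᶻ_; _*_ to _*ᶻ_; _^_ to _^ᶻ_)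
open import Data.Integer.DivMod using (n%ℕd<d; a≡a%ℕn+[a/ℕn]*n)
open import Data.Integer.Divisibility.Signed
  using (_∣_; divides; ∣m∣n⇒∣m+n; ∣m⇒∣-m; ∣n⇒∣m*n; ∣m⇒∣m*n)
open import Data.Integer.Properties using (^-zeroˡ; ^-*-assoc; +-identityʳ; +-identityˡ)
open import Data.Integer.Tactic.RingSolver using (solve-∀)
open import Data.Nat using (ℕ; zero; suc; _+_; _*_; _∸_; _≤_; _<_; _≥_; z≤n; s≤s; s≤s⁻¹; NonZero)
open import Data.Nat.Coprimality using (Coprime; coprime-Bézout; prime⇒coprime)
open import Data.Nat.Divisibility using () renaming (_∣_ to _∣ℕ_; divides to dividesℕ)
open import Data.Nat.GCD using (module Bézout)
open import Data.Nat.Primality using (Prime; prime[2]; ¬prime[0]; ¬prime[1])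
open import Data.Nat.Properties
  using (≤∧≢⇒<; m∸n+n≡m; +-monoʳ-<; +-suc; *-comm; *-identityʳ; n<1+n; _≟_)
open import Data.Product using (_×_; _,_; ∃; proj₁; proj₂)
open import Data.Sum using (inj₁; inj₂)
open import Function using (_$_)
open import Function.Endo.Propositional ℤ using (^-homo) renaming (_^_ to iterate)
open import Relation.Binary using (IsEquivalence; Setoid)
open import Relation.Binary.PropositionalEquality
  using (_≡_; refl; sym; trans; cong; cong-app; subst)
import Relation.Binary.Reasoning.Setoid as SetoidReasoning
open import Relation.Nullary using (yes; no; contradiction)
open import Relation.Unary using (_≐_; _∪_; ｛_｝)

module Congruence (m : ℤ) where

  infix 4 _≈_

  -- A record rather than a plain synonym for the divisibility: `x` and `y` can then be inferred
  -- from the type, which unification cannot do from `x - y`.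
  record _≈_ (x y : ℤ) : Set where
    constructor congruent
    field difference : m ∣ x - y

  open _≈_ public

  ≈-refl : ∀ {x} → x ≈ x
  ≈-refl {x} = congruent (divides 0ℤ (lemma x m))
    where
    lemma : ∀ x m → x - x ≡ 0ℤ *ᶻ m
    lemma = solve-∀

  ≈-sym : ∀ {x y} → x ≈ y → y ≈ x
  ≈-sym {x} {y} (congruent p) = congruent (subst (m ∣_) (lemma x y) (∣m⇒∣-m p))
    where
    lemma : ∀ x y → - (x - y) ≡ y - x
    lemma = solve-∀

  ≈-trans : ∀ {x y z} → x ≈ y → y ≈ z → x ≈ z
  ≈-trans {x} {y} {z} (congruent p) (congruent q) =
    congruent (subst (m ∣_) (lemma x y z) (∣m∣n⇒∣m+n p q))
    where
    lemma : ∀ x y z → (x - y) +ᶻ (y - z) ≡ x - z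
    lemma = solve-∀

  ≈-setoid : Setoid _ _
  ≈-setoid = record
    { _≈_ = _≈_
    ; isEquivalence = record { refl = ≈-refl ; sym = ≈-sym ; trans = ≈-trans }
    }

  +-cong : ∀ {x y u v} → x ≈ y → u ≈ v → x +ᶻ u ≈ y +ᶻ v
  +-cong {x} {y} {u} {v} (congruent p) (congruent q) =
    congruent (subst (m ∣_) (lemma x y u v) (∣m∣n⇒∣m+n p q))
    where
    lemma : ∀ x y u v → (x - y) +ᶻ (u - v) ≡ (x +ᶻ u) - (y +ᶻ v)
    lemma = solve-∀

  *-cong : ∀ {x y u v} → x ≈ y → u ≈ v → x *ᶻ u ≈ y *ᶻ v
  *-cong {x} {y} {u} {v} (congruent p) (congruent q) =
    congruent (subst (m ∣_) (lemma x y u v) (∣m∣n⇒∣m+n (∣m⇒∣m*n u p) (∣n⇒∣m*n y q)))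
    where
    lemma : ∀ x y u v → (x - y) *ᶻ u +ᶻ y *ᶻ (u - v) ≡ x *ᶻ u - y *ᶻ v
    lemma = solve-∀

  ^-cong : ∀ n {x y} → x ≈ y → x ^ᶻ n ≈ y ^ᶻ n
  ^-cong zero    p = ≈-refl
  ^-cong (suc n) p = *-cong p (^-cong n p)

  φ-cong : ∀ d c {x y} → x ≈ y → φ d c x ≈ φ d c y
  φ-cong d c p = +-cong (^-cong d p) ≈-refl

  ∣⇒≈0 : ∀ {x} → m ∣ x → x ≈ 0ℤ
  ∣⇒≈0 {x} p = congruent (subst (m ∣_) (sym (+-identityʳ x)) p)

  ≈0⇒∣ : ∀ {x} → x ≈ 0ℤ → m ∣ x
  ≈0⇒∣ {x} (congruent p) = subst (m ∣_) (+-identityʳ x) p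

module Orbit {ℓ} (_≈_ : ℤ → ℤ → Set ℓ) (isEquivalence : IsEquivalence _≈_)
             (f : ℤ → ℤ) (f-cong : ∀ {x y} → x ≈ y → f x ≈ f y) where

  orbitSetoid : Setoid _ _
  orbitSetoid = record { isEquivalence = isEquivalence }

  open SetoidReasoning orbitSetoid

  iterate-cong : ∀ n {x y} → x ≈ y → iterate f n x ≈ iterate f n y
  iterate-cong zero    p = p
  iterate-cong (suc n) p = f-cong (iterate-cong n p)

  iterate-+ : ∀ m n x → iterate f (m + n) x ≡ iterate f m (iterate f n x)
  iterate-+ m n = cong-app (^-homo f m n)

  period-+ : ∀ {x} m n → iterate f n x ≈ x → iterate f (m + n) x ≈ iterate f m x
  period-+ {x} m n p = begin
    iterate f (m + n) x           ≡⟨ iterate-+ m n x ⟩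
    iterate f m (iterate f n x)   ≈⟨ iterate-cong m p ⟩
    iterate f m x                 ∎

  period-* : ∀ {x} k n → iterate f n x ≈ x → iterate f (k * n) x ≈ x
  period-* zero        n p = IsEquivalence.refl isEquivalence
  period-* {x} (suc k) n p = begin
    iterate f (n + k * n) x   ≈⟨ period-+ n (k * n) (period-* k n p) ⟩
    iterate f n x             ≈⟨ p ⟩
    x                         ∎

  -- Bézout's identity over the naturals yields a multiple of one period that exceeds a multiple of
  -- the other by exactly 1. Both multiples are return times, so a single step is one too. The two
  -- cases say which multiple is the larger.
  coprime-periods⇒fixed : ∀ {x a b} → Coprime a b →
    iterate f a x ≈ x → iterate f b x ≈ x → f x ≈ x
  coprime-periods⇒fixed {x} {a} {b} coprime p q with coprime-Bézout coprime
  ... | Bézout.+- u v eq = begin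
    f x                       ≈⟨ period-+ 1 (v * b) (period-* v b q) ⟨
    iterate f (1 + v * b) x   ≡⟨ cong (λ n → iterate f n x) eq ⟩
    iterate f (u * a) x       ≈⟨ period-* u a p ⟩
    x                         ∎
  ... | Bézout.-+ u v eq = begin
    f x                       ≈⟨ period-+ 1 (u * a) (period-* u a p) ⟨
    iterate f (1 + u * a) x   ≡⟨ cong (λ n → iterate f n x) eq ⟩
    iterate f (v * b) x       ≈⟨ period-* v b q ⟩
    x                         ∎

  -- From the collision on, both orbits agree; the `n ∸ j` steps that complete the `j`-th point to
  -- the `n`-th, hence to `x`, also take the `i`-th point to `x`.
  collision⇒period : ∀ {x} n i j → j ≤ n → iterate f n x ≈ x →
    iterate f i x ≈ iterate f j x → iterate f ((n ∸ j) + i) x ≈ x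
  collision⇒period {x} n i j j≤n p q = begin
    iterate f ((n ∸ j) + i) x           ≡⟨ iterate-+ (n ∸ j) i x ⟩
    iterate f (n ∸ j) (iterate f i x)   ≈⟨ iterate-cong (n ∸ j) q ⟩
    iterate f (n ∸ j) (iterate f j x)   ≡⟨ iterate-+ (n ∸ j) j x ⟨
    iterate f ((n ∸ j) + j) x           ≡⟨ cong (λ k → iterate f k x) (m∸n+n≡m j≤n) ⟩
    iterate f n x                       ≈⟨ p ⟩
    x                                   ∎

module _ (n : ℕ) where
  open Congruence (+ suc n)

  ≈-remainder : ∀ x → x ≈ + (x %ℕ suc n)
  ≈-remainder x = congruent $ divides (x /ℕ suc n) $
    trans (cong (_- + r) (a≡a%ℕn+[a/ℕn]*n x (suc n))) (lemma (+ r) (x /ℕ suc n *ᶻ + suc n))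
    where
    r = x %ℕ suc n
    lemma : ∀ r q → (r +ᶻ q) - r ≡ q
    lemma = solve-∀

  n≈-1 : + n ≈ - 1ℤ
  n≈-1 = congruent (divides 1ℤ (lemma (+ n)))
    where
    lemma : ∀ x → x - (- 1ℤ) ≡ 1ℤ *ᶻ (1ℤ +ᶻ x)
    lemma = solve-∀

  -- The residue n ≡ -1 is superfluous as a representative, since f (-1) = f 1.
  even-map-representative : (f : ℤ → ℤ) → (∀ {x y} → x ≈ y → f x ≈ f y) →
    (∀ x → f (- x) ≡ f x) → 1 < n → ∀ x → ∃ λ (r : Fin n) → f x ≈ f (+ toℕ r)
  even-map-representative f f-cong f-even 1<n x with x %ℕ suc n ≟ n
  ... | yes r≡n = fromℕ< 1<n , (begin
    f x                         ≈⟨ f-cong (≈-remainder x) ⟩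
    f (+ (x %ℕ suc n))          ≡⟨ cong (λ k → f (+ k)) r≡n ⟩
    f (+ n)                     ≈⟨ f-cong n≈-1 ⟩
    f (- 1ℤ)                    ≡⟨ f-even 1ℤ ⟩
    f 1ℤ                        ≡⟨ cong (λ k → f (+ k)) (toℕ-fromℕ< 1<n) ⟨
    f (+ toℕ (fromℕ< 1<n))      ∎)
    where open SetoidReasoning ≈-setoid
  ... | no r≢n = fromℕ< r<n , (begin
    f x                         ≈⟨ f-cong (≈-remainder x) ⟩
    f (+ (x %ℕ suc n))          ≡⟨ cong (λ k → f (+ k)) (toℕ-fromℕ< r<n) ⟨
    f (+ toℕ (fromℕ< r<n))      ∎)
    where
    open SetoidReasoning ≈-setoid
    r<n : x %ℕ suc n < n
    r<n = ≤∧≢⇒< (s≤s⁻¹ (n%ℕd<d x (suc n))) r≢n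

  even-map-prime-period⇒fixed : (f : ℤ → ℤ) → (∀ {x y} → x ≈ y → f x ≈ f y) →
    (∀ x → f (- x) ≡ f x) → 1 < n → Prime (suc n) →
    ∀ {x} → iterate f (suc n) x ≈ x → f x ≈ x
  even-map-prime-period⇒fixed f f-cong f-even 1<n pr {x} period
    -- The `suc n` orbit points with indices 0 to `n` have only `n` possible representatives.
    with i , j , i<j , eq ← pigeonhole (n<1+n n)
           (λ i → proj₁ (even-map-representative f f-cong f-even 1<n (iterate f (toℕ i) x)))
    = coprime-periods⇒fixed (prime⇒coprime pr {{k≢0}} k<p) period
        -- The images under `f` collide, not the points themselves, so both indices move up by one.
        (collision⇒period (suc n) (suc (toℕ i)) (suc (toℕ j)) (toℕ<n j) period collision)
    where
    open Orbit _≈_ (Setoid.isEquivalence ≈-setoid) f f-cong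
    open SetoidReasoning ≈-setoid

    representative : ∀ y → ∃ λ (r : Fin n) → f y ≈ f (+ toℕ r)
    representative = even-map-representative f f-cong f-even 1<n

    xᵢ = iterate f (toℕ i) x
    xⱼ = iterate f (toℕ j) x

    collision : f xᵢ ≈ f xⱼ
    collision = begin
      f xᵢ                                    ≈⟨ proj₂ (representative xᵢ) ⟩
      f (+ toℕ (proj₁ (representative xᵢ)))   ≡⟨ cong (λ t → f (+ toℕ t)) eq ⟩
      f (+ toℕ (proj₁ (representative xⱼ)))   ≈⟨ proj₂ (representative xⱼ) ⟨
      f xⱼ                                    ∎

    -- This is p - (j - i) for p = `suc n`: positive because of the summand `suc (toℕ i)`, and below
    -- p because i < j.
    k = (suc n ∸ suc (toℕ j)) + suc (toℕ i)

    k≢0 : NonZero k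
    k≢0 = subst NonZero (sym (+-suc (suc n ∸ suc (toℕ j)) (toℕ i))) _

    k<p : k < suc n
    k<p = subst (k <_) (m∸n+n≡m (toℕ<n j)) (+-monoʳ-< (suc n ∸ suc (toℕ j)) (s≤s i<j))

-- For even `d` the power factors through the square of `x`, where the sign disappears.
φ-even : ∀ {d} c → 2 ∣ℕ d → ∀ x → φ d c (- x) ≡ φ d c x
φ-even {d} c (dividesℕ q refl) x = cong (_+ᶻ c) $
  trans (as-square (- x)) $ trans (cong (_^ᶻ q) (lemma x)) $ sym (as-square x)
  where
  as-square : ∀ y → y ^ᶻ (q * 2) ≡ (y ^ᶻ 2) ^ᶻ q
  as-square y = trans (cong (y ^ᶻ_) (*-comm q 2)) (sym (^-*-assoc y 2 q))
  -- Both sides are the squares in the form to which `_^ᶻ 2` unfolds.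
  lemma : ∀ y → (- y) *ᶻ ((- y) *ᶻ 1ℤ) ≡ y *ᶻ (y *ᶻ 1ℤ)
  lemma = solve-∀

φ-0 : ∀ {d} c → d ≥ 2 → φ d c 0ℤ ≡ c
-- Matching exposes `d` as a successor, so the power of 0 computes to 0; with exponent 0 it would be
-- 1.
φ-0 c (s≤s _) = +-identityˡ c

-- Modulo a divisor of `c` the point 0 is fixed, so 1 is a return time and every `n` is a multiple
-- of it.
∣c⇒∣iterate : ∀ {d c} m n → d ≥ 2 → m ∣ c → m ∣ iterate (φ d c) n 0ℤ
∣c⇒∣iterate {d} {c} m n d≥2 m∣c = ≈0⇒∣ $
  subst (λ k → iterate (φ d c) k 0ℤ ≈ 0ℤ) (*-identityʳ n) $
  period-* n 1 (∣⇒≈0 (subst (m ∣_) (sym (φ-0 c d≥2)) m∣c))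
  where
  open Congruence m
  open Orbit _≈_ (Setoid.isEquivalence ≈-setoid) (φ d c) (φ-cong d c)

-- Split on the parity of `c`: if it is even, 0 is fixed modulo 2; if it is odd, the orbit runs 0,
-- 1, 0, since the second iterate is a sum of two odd numbers.
2∣iterate : ∀ {d} c → d ≥ 2 → + 2 ∣ iterate (φ d c) 2 0ℤ
2∣iterate {d} c d≥2 with c %ℕ 2 | n%ℕd<d c 2 | ≈-remainder 1 c
... | 0 | _ | c≈0 = ∣c⇒∣iterate (+ 2) 2 d≥2 (Congruence.≈0⇒∣ (+ 2) c≈0)
... | 1 | _ | c≈1 = ≈0⇒∣ $ begin
  φ d c (φ d c 0ℤ)   ≡⟨ cong (φ d c) (φ-0 c d≥2) ⟩
  c ^ᶻ d +ᶻ c        ≈⟨ +-cong (^-cong d c≈1) c≈1 ⟩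
  1ℤ ^ᶻ d +ᶻ 1ℤ      ≡⟨ cong (_+ᶻ 1ℤ) (^-zeroˡ d) ⟩
  + 2                ≈⟨ congruent (divides 1ℤ refl) ⟩
  0ℤ                 ∎
  where
  open Congruence (+ 2)
  open SetoidReasoning ≈-setoid
... | suc (suc _) | s≤s (s≤s ()) | _

theorem1p6 : ∀ (d : ℕ) (c : ℤ) → d ≥ 2 → 2 ∣ℕ d →
    P d c ≐ (｛ 2 ｝ ∪ (λ p → Prime p × + p ∣ c))
theorem1p6 d c d≥2 2∣d = to , from
  where
  to : ∀ {p} → P d c p → (｛ 2 ｝ ∪ (λ p → Prime p × + p ∣ c)) p
  to {0} (pr , _) = contradiction pr ¬prime[0]
  to {1} (pr , _) = contradiction pr ¬prime[1]
  to {2} _           = inj₁ refl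
  -- Here p = `suc n` is at least 3, which gives the bound 1 < n needed to have 1 among the
  -- representatives. That 0 is fixed modulo p means that p divides `φ d c 0ℤ`, which is `c`.
  to {suc n@(suc (suc _))} (pr , p∣) = inj₂ (pr , subst (+ suc n ∣_) (φ-0 c d≥2)
    (≈0⇒∣ (even-map-prime-period⇒fixed n (φ d c) (φ-cong d c) (φ-even c 2∣d)
      (s≤s (s≤s z≤n)) pr (∣⇒≈0 p∣))))
    where open Congruence (+ suc n)

  from : ∀ {p} → (｛ 2 ｝ ∪ (λ p → Prime p × + p ∣ c)) p → P d c p
  from (inj₁ refl)          = prime[2] , 2∣iterate c d≥2
  from {p} (inj₂ (pr , p∣c)) = pr , ∣c⇒∣iterate (+ p) p d≥2 p∣c
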